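{- Let $X$ be a homogeneously self-similar graph (not assumed locally finite) with constant inner degree $b$ such that $b>\theta_X-1$, and let $v$ be a vertex in $VX$. Then the following statements are equivalent: (i) The degree of $v$ is infinite. (ii) The vertex $v$ is contained in $F^n$ for any positive integer $n$. (iii) The vertex $v$ is an origin vertex.
   Context: Graph $X$ with vertex set $VX$ and edge set $EX$ is connected, infinite, without loops or multiple edges; vertices may have infinite degree. $d_X$ is the graph distance and $\deg_X x$ the number of neighbours of $x$ in $X$. For $C\subset VX$, the boundary $\theta C$ is the set of vertices in $VX\setminus C$ adjacent to some vertex of $C$; the closure is $\overline{C}=C\cup\theta C$; $\hat C$ is the subgraph of $X$ spanned (induced) by $\overline{C}$. For $F\subset VX$, $\mathcal{C}_XF$ denotes the set of connected components of $VX\setminus F$ (as vertex sets). The reduced graph $X_F$ has vertex set $F$, and two (distinct) vertices $x,y\in F$ are adjacent in $X_F$ iff there is $C\in\mathcal{C}_XF$ with $x,y\in\theta C$. $X$ is self-similar with respect to $F\subset VX$ and $\psi:VX\to F$ if: (F1) no two vertices of $F$ are adjacent in $X$; (F2) the intersection of the closures of two different components in $\mathcal{C}_XF$ contains at most one vertex; (F3) $\psi$ is a graph isomorphism from $X$ to $X_F$. Put $F^0=VX$, $F^n=\psi^n(VX)$ (so $F^1=F$). Elements of $\mathcal{C}_XF$ are called cells. An origin vertex is a fixed point of $\psi$. A self-similar graph $X$ is homogeneously self-similar if: (H1) all cell graphs $\hat C$ ($C\in\mathcal{C}_XF$) are finite and for any cells $C,D$ there is a graph isomorphism $\alpha:\hat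 C\to\hat D$ with $\alpha(\theta C)=\theta D$; (H2) for every cell $C$ and $v_1,v_2,v_3,v_4\in\theta C$ with $v_1\neq v_2$, $v_3\ne v_4$, one has $d_X(v_1,v_2)=d_X(v_3,v_4)$. Put $\theta_X=|\theta C|$ for a cell $C$ (independent of the choice of $C$). A number $b$ is a constant inner degree of $X$ if $b=\deg_{\hat C}v$ for every cell $C$ and every $v\in\theta C$. -}

module Defs where

open import Level using (Level; _⊔_; suc)
open import Data.Nat.Base as ℕ using (ℕ; _≤_)
open import Data.Nat.GeneralisedArithmetic using (fold)
open import Data.List.Base as List using (List)
open import Data.List.Membership.Propositional renaming (_∈_ to _∈ₗ_) using ()
open import Data.List.Relation.Unary.Unique.Propositional using (Unique)
open import Data.Product.Base using (_×_; _,_; ∃-syntax; Σ-syntax)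
open import Function.Bundles using (_⇔_)
open import Relation.Nullary.Negation.Core using (¬_)
open import Relation.Unary using (Pred; _∈_; _∉_; _≐_; _∪_; ∁; U)
open import Relation.Binary.Core using (Rel)
open import Relation.Binary.Definitions using (Symmetric; Irreflexive)
open import Relation.Binary.PropositionalEquality.Core using (_≡_; _≢_; sym)
open import Relation.Binary.Construct.Closure.ReflexiveTransitive
  using (Star; ε; _◅_)

private
  variable
    a c d e p q v ℓ : Level

-- Cardinality of a subset given by a predicate.  A duplicate-free list is used
-- rather than a bijection between Fin n and ∃ P, since ∃ P would count
-- the different proofs of P x as different elements.

HasSize : {A : Set a} → Pred A p → ℕ → Set (a ⊔ p)
HasSize {A = A} P n =
  Σ[ xs ∈ List A ] Unique xs × List.length xs ≡ n × (∀ x → x ∈ P ⇔ x ∈ₗ xs)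

Finite : {A : Set a} → Pred A p → Set (a ⊔ p)
Finite P = ∃[ n ] HasSize P n

Infinite : {A : Set a} → Pred A p → Set (a ⊔ p)
Infinite P = ¬ Finite P

image : {A : Set a} {B : Set c} → (A → B) → Pred A p → Pred B (a ⊔ c ⊔ p)
image f P y = ∃[ x ] x ∈ P × f x ≡ y

record Graph (V : Set v) (e : Level) : Set (v ⊔ suc e) where
  field
    _~_      : Rel V e
    ~-sym    : Symmetric _~_
    ~-irrefl : Irreflexive _≡_ _~_

-- A graph whose vertex set is a subset S of V is given by a Graph on V together
-- with S, only the adjacencies between elements of S being relevant.  This is
-- the statement that φ restricts to an isomorphism from the subgraph of G
-- spanned by S onto the subgraph of H spanned by T.

record IsIsomorphism {V : Set v} {W : Set a}
                     (G : Graph V c) (S : Pred V p)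
                     (H : Graph W d) (T : Pred W q)
                     (φ : V → W) : Set (v ⊔ a ⊔ c ⊔ d ⊔ p ⊔ q) where
  private
    module G = Graph G
    module H = Graph H
  field
    maps-to    : ∀ {x} → x ∈ S → φ x ∈ T
    injective  : ∀ {x y} → x ∈ S → y ∈ S → φ x ≡ φ y → x ≡ y
    surjective : ∀ {y} → y ∈ T → ∃[ x ] x ∈ S × φ x ≡ y
    adjacency  : ∀ {x y} → x ∈ S → y ∈ S → (x G.~ y) ⇔ (φ x H.~ φ y)

module _ {V : Set v} (X : Graph V e) where
  open Graph X

  Connected : Set (v ⊔ e)
  Connected = ∀ x y → Star _~_ x y

  length : ∀ {x y} → Star _~_ x y → ℕ
  length ε       = 0
  length (_ ◅ w) = ℕ.suc (length w)

  -- d_X(x , y) = n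
  Distance : V → V → ℕ → Set (v ⊔ e)
  Distance x y n =
    (∃[ w ] length {x} {y} w ≡ n) × (∀ (w : Star _~_ x y) → n ≤ length w)

  neighbours : V → Pred V e
  neighbours x y = x ~ y

  -- The neighbours of x in the subgraph of X spanned by S.
  neighboursIn : Pred V p → V → Pred V (e ⊔ p)
  neighboursIn S x y = y ∈ S × x ~ y

  boundary : Pred V p → Pred V (v ⊔ e ⊔ p)
  boundary C y = y ∉ C × (∃[ x ] x ∈ C × x ~ y)

  closure : Pred V p → Pred V (v ⊔ e ⊔ p)
  closure C = C ∪ boundary C

  ConnectedIn : Pred V p → Rel V (v ⊔ e ⊔ p)
  ConnectedIn S = Star (λ x y → x ∈ S × y ∈ S × x ~ y)

  IsComponent : Pred V p → Pred V q → Set (v ⊔ e ⊔ p ⊔ q)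
  IsComponent S C = ∃[ z ] z ∈ S × C ≐ ConnectedIn S z

-- V, adjacency, F and the cells share one level ℓ, so that the connected
-- components of V ∖ F are themselves predicates of level ℓ.

module _ {V : Set ℓ} (X : Graph V ℓ) (F : Pred V ℓ) where
  open Graph X

  IsCell : Pred V ℓ → Set ℓ
  IsCell C = IsComponent X (∁ F) C

  -- X_F; its vertex set is F, so it is always used together with F.
  reduced : Graph V (suc ℓ)
  reduced = record
    { _~_      = λ x y → x ∈ F × y ∈ F × x ≢ y ×
                   (∃[ C ] IsCell C × x ∈ boundary X C × y ∈ boundary X C)
    ; ~-sym    = λ (x∈F , y∈F , x≢y , C , cell , x∈θC , y∈θC) →
                   y∈F , x∈F , (λ y≡x → x≢y (sym y≡x)) , C , cell , y∈θC , x∈θC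
    ; ~-irrefl = λ x≡y (_ , _ , x≢y , _) → x≢y x≡y
    }

  record IsSelfSimilar (ψ : V → V) : Set (suc ℓ) where
    field
      F1 : ∀ {x y} → x ∈ F → y ∈ F → ¬ (x ~ y)
      F2 : ∀ {C D} → IsCell C → IsCell D → ¬ (C ≐ D) →
           ∀ {x y} → x ∈ closure X C → x ∈ closure X D →
                     y ∈ closure X C → y ∈ closure X D → x ≡ y
      F3 : IsIsomorphism X U reduced F ψ

  record IsHomogeneouslySelfSimilar (ψ : V → V) : Set (suc ℓ) where
    field
      selfSimilar : IsSelfSimilar ψ
      H1-finite   : ∀ {C} → IsCell C → Finite (closure X C)
      H1-iso      : ∀ {C D} → IsCell C → IsCell D →
                    Σ[ α ∈ (V → V) ]
                      IsIsomorphism X (closure X C) X (closure X D) α ×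
                      image α (boundary X C) ≐ boundary X D
      H2          : ∀ {C} → IsCell C → ∀ {v₁ v₂ v₃ v₄} →
                    v₁ ∈ boundary X C → v₂ ∈ boundary X C →
                    v₃ ∈ boundary X C → v₄ ∈ boundary X C →
                    v₁ ≢ v₂ → v₃ ≢ v₄ →
                    ∃[ n ] Distance X v₁ v₂ n × Distance X v₃ v₄ n

  -- θ_X = t
  HasBoundarySize : ℕ → Set (suc ℓ)
  HasBoundarySize t = ∀ {C} → IsCell C → HasSize (boundary X C) t

  IsConstantInnerDegree : ℕ → Set (suc ℓ)
  IsConstantInnerDegree b =
    ∀ {C} → IsCell C → ∀ {x} → x ∈ boundary X C →
    HasSize (neighboursIn X (closure X C) x) b

-- Fⁿ = ψⁿ(V)
iterateImage : {V : Set v} → (V → V) → ℕ → Pred V v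
iterateImage ψ n y = ∃[ x ] fold x ψ n ≡ y

IsOrigin : {V : Set v} → (V → V) → Pred V v
IsOrigin ψ x = ψ x ≡ x

{-# OPTIONS --safe #-}

-- Let v ∈ F lie in the closures of exactly k cells.  Then deg_X v = b k, since
-- by F1 every neighbour of v lies in exactly one of these cells, while
-- deg_{X_F} v = (θ_X − 1) k by F2.  Hence a vertex ψ w of infinite degree comes
-- from a vertex w of infinite degree, so it lies in every Fⁿ; and an origin
-- vertex of finite degree d would satisfy d b = d (θ_X − 1), which forces d = 0
-- as θ_X − 1 < b.  On the other hand a walk between two vertices of F spends at
-- least two edges in each cell it visits, so ψ at least doubles distances and
-- ⋂ Fⁿ has at most one element, which ψ must therefore fix.

module Submission where

open import Defs
open import Axiom.ExcludedMiddle using (ExcludedMiddle)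
open import Data.Empty using (⊥-elim)
open import Data.Nat.Base using (ℕ; zero; suc; _+_; _*_; _<_; _≤_; z≤n; s≤s)
open import Data.Nat.GeneralisedArithmetic using (fold)
open import Data.Nat.ListAction using (sum)
open import Data.Nat.Properties
  using (+-comm; +-suc; *-zeroʳ; *-cancelˡ-≡; suc-injective; ≤-trans; ≤-reflexive; ≤-pred;
         m≤n⇒m≤1+n; m≤n+m; n≤1+n; <⇒≢; +-commutativeSemigroup)
open import Algebra.Properties.CommutativeSemigroup +-commutativeSemigroup using (x∙yz≈y∙xz)
open import Data.List.Base as List using (List; []; _∷_; filter; deduplicate; concatMap)
open import Data.List.Properties using (length-map)
open import Data.List.Membership.Propositional using (lose) renaming (_∈_ to _∈ₗ_)
open import Data.List.Membership.Propositional.Properties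
  using (∈-filter⁺; ∈-filter⁻; ∈-deduplicate⁺; ∈-deduplicate⁻; ∈-concatMap⁺; ∈-map⁺; ∈-map⁻)
open import Data.List.Membership.Propositional.Properties.WithK using (unique∧set⇒bag)
open import Data.List.Relation.Binary.BagAndSetEquality using (∼bag⇒↭)
open import Data.List.Relation.Binary.Permutation.Propositional.Properties using (↭-length)
open import Data.List.Relation.Unary.All as All using (_∷_)
import Data.List.Relation.Unary.All.Properties as All
open import Data.List.Relation.Unary.AllPairs using (_∷_)
open import Data.List.Relation.Unary.Any using (here; there)
open import Data.List.Relation.Unary.Unique.Propositional using (Unique)
import Data.List.Relation.Unary.Unique.Propositional.Properties as Unique
import Data.List.Relation.Unary.Unique.DecPropositional.Properties as UniqueDec
open import Data.Product.Base using (_×_; _,_; proj₁; proj₂; ∃-syntax; Σ-syntax)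
open import Data.Sum.Base using (inj₁; inj₂)
open import Function.Base using (_∘_)
open import Function.Bundles using (_⇔_; mk⇔; Equivalence)
open import Level using (Level)
open import Relation.Binary.Construct.Closure.ReflexiveTransitive
  using (Star; ε; _◅_; _◅◅_; reverse)
open import Relation.Binary.Core using (REL)
import Relation.Binary.Definitions as B
open import Relation.Binary.PropositionalEquality
  using (_≡_; _≢_; refl; sym; trans; cong; cong₂; subst; module ≡-Reasoning)
open import Relation.Nullary using (¬_; Dec; yes; no; contradiction)
open import Relation.Nullary.Decidable using (decidable-stable)
open import Relation.Unary using (Pred; _∈_; _∉_; _⊆_; _≐_; ∁; U)

open Equivalence using (to; from)

private
  variable
    a p q r ℓ : Level
    A B : Set a

-- Double counting and cardinalities of lists.

sum-map-const : ∀ (f : A → ℕ) {c} xs → (∀ {x} → x ∈ₗ xs → f x ≡ c) →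
                sum (List.map f xs) ≡ List.length xs * c
sum-map-const f []       f≡c = refl
sum-map-const f (x ∷ xs) f≡c =
  cong₂ _+_ (f≡c (here refl)) (sum-map-const f xs (f≡c ∘ there))

module _ {R : REL A B r} (R? : B.Decidable R) where

  row : List B → A → ℕ
  row ys x = List.length (filter (R? x) ys)

  column : List A → B → ℕ
  column xs y = List.length (filter (λ x → R? x y) xs)

  -- Prepending `x` adds one to the column of each `y` related to `x`, and these `y` make up the row
  -- of `x`.
  column-∷ : ∀ x xs ys →
    row ys x + sum (List.map (column xs) ys) ≡ sum (List.map (column (x ∷ xs)) ys)
  column-∷ x xs []       = refl
  column-∷ x xs (y ∷ ys) with R? x y
  ... | yes _ = cong suc (trans (x∙yz≈y∙xz (row ys x) (column xs y) _)
                                (cong (column xs y +_) (column-∷ x xs ys)))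
  ... | no  _ = trans (x∙yz≈y∙xz (row ys x) (column xs y) _)
                      (cong (column xs y +_) (column-∷ x xs ys))

  double-counting : ∀ xs ys →
    sum (List.map (row ys) xs) ≡ sum (List.map (column xs) ys)
  double-counting []       ys = sym (trans (sum-map-const (column []) ys (λ _ → refl))
                                           (*-zeroʳ (List.length ys)))
  double-counting (x ∷ xs) ys =
    trans (cong (row ys x +_) (double-counting xs ys)) (column-∷ x xs ys)

-- Duplicate-free lists with the same elements are permutations of each other.
HasSize⇒length : ∀ {P : Pred A p} {n} → HasSize P n →
                 ∀ {xs} → Unique xs → (∀ x → x ∈ P ⇔ x ∈ₗ xs) → List.length xs ≡ n
HasSize⇒length (ys , ys! , refl , P⇔ys) xs! P⇔xs =
  ↭-length (∼bag⇒↭ (unique∧set⇒bag xs! ys!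
    (λ {x} → mk⇔ (to (P⇔ys x) ∘ from (P⇔xs x)) (to (P⇔xs x) ∘ from (P⇔ys x)))))

∃-other : ∀ {P : Pred A p} {n} → HasSize P n → 2 ≤ n →
          B.DecidableEquality A → ∀ v → ∃[ u ] u ∈ P × u ≢ v
∃-other ([] , _ , refl , _) () _ _
∃-other (_ ∷ [] , _ , refl , _) (s≤s ()) _ _
∃-other (x ∷ y ∷ _ , ((x≢y ∷ _) ∷ _) , _ , P⇔xs) _ _≟_ v with x ≟ v
... | no  x≢v = x , from (P⇔xs x) (here refl) , x≢v
... | yes x≡v = y , from (P⇔xs y) (there (here refl)) , λ y≡v → x≢y (trans x≡v (sym y≡v))

two-elements⇒2≤ : ∀ {P : Pred A p} {n} → HasSize P n →
                  ∀ {x y} → x ∈ P → y ∈ P → x ≢ y → 2 ≤ n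
two-elements⇒2≤ ([] , _ , refl , P⇔) {x} x∈P _ _ with () ← to (P⇔ x) x∈P
two-elements⇒2≤ (z ∷ [] , _ , refl , P⇔) {x} {y} x∈P y∈P x≢y
  with here refl ← to (P⇔ x) x∈P | here refl ← to (P⇔ y) y∈P = contradiction refl x≢y
two-elements⇒2≤ (_ ∷ _ ∷ _ , _ , refl , _) _ _ _ = s≤s (s≤s z≤n)

doubled-≤-suc : ∀ m {n} → m + m ≤ suc n → m ≤ n
doubled-≤-suc zero    _           = z≤n
doubled-≤-suc (suc m) (s≤s m+m≤n) = ≤-trans (m≤n+m (suc m) m) m+m≤n

fold-comm : ∀ (f : A → A) x n → fold (f x) f n ≡ f (fold x f n)
fold-comm f x zero    = refl
fold-comm f x (suc n) = cong f (fold-comm f x n)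

fixed⇒fold-fixed : ∀ (f : A → A) {x} → f x ≡ x → ∀ n → fold x f n ≡ x
fixed⇒fold-fixed f fx≡x zero    = refl
fixed⇒fold-fixed f fx≡x (suc n) = trans (cong f (fixed⇒fold-fixed f fx≡x n)) fx≡x

module _ (em : ∀ {a} → ExcludedMiddle a) where

  -- Excluded middle decides membership and equality, so elements outside `P` and repetitions can be
  -- removed from `zs`.
  ⊆-list⇒Finite : ∀ {P : Pred A p} zs → (∀ {x} → x ∈ P → x ∈ₗ zs) → Finite P
  ⊆-list⇒Finite {P = P} zs P⊆zs =
    List.length ys , ys , UniqueDec.deduplicate-! _≟_ _ , refl , λ x → mk⇔
      (λ x∈P → ∈-deduplicate⁺ _≟_ (∈-filter⁺ P? (P⊆zs x∈P) x∈P))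
      (λ x∈ys → proj₂ (∈-filter⁻ P? {xs = zs} (∈-deduplicate⁻ _≟_ (filter P? zs) x∈ys)))
    where
    _≟_ : B.DecidableEquality _
    _ ≟ _ = em
    P? : ∀ x → Dec (x ∈ P)
    P? _ = em
    ys = deduplicate _≟_ (filter P? zs)

  ⊆-Finite : ∀ {P : Pred A p} {Q : Pred A q} → P ⊆ Q → Finite Q → Finite P
  ⊆-Finite P⊆Q (_ , zs , _ , _ , Q⇔zs) = ⊆-list⇒Finite zs (to (Q⇔zs _) ∘ P⊆Q)

  module _ {V : Set ℓ} (X : Graph V ℓ) where
    open Graph X

    ∃-neighbour : Connected X → Infinite (U {A = V}) → ∀ v → ∃[ u ] v ~ u
    ∃-neighbour conn inf v with em {P = ∃[ y ] y ≢ v}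
    ... | no  none    = ⊥-elim (inf (⊆-list⇒Finite (v ∷ [])
                          (λ {y} _ → here (decidable-stable em (none ∘ (y ,_))))))
    ... | yes (y , y≢v) = first-step (conn v y)
      where
      first-step : Star _~_ v y → ∃[ u ] v ~ u
      first-step ε         = contradiction refl y≢v
      first-step (v~u ◅ _) = _ , v~u

    -- Components of the complement of `F`.

    module Cells (F : Pred V ℓ) where

      cell-of : V → Pred V ℓ
      cell-of = ConnectedIn X (∁ F)

      cell-of-isCell : ∀ {z} → z ∉ F → IsCell X F (cell-of z)
      cell-of-isCell {z} z∉F = z , z∉F , (λ w → w) , (λ w → w)

      cell⊆∁F : ∀ {C} → IsCell X F C → ∀ {x} → x ∈ C → x ∉ F
      cell⊆∁F (z , z∉F , C⊆ , _) x∈C = go z∉F (C⊆ x∈C)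
        where
        go : ∀ {z x} → z ∉ F → cell-of z x → x ∉ F
        go z∉F ε                    = z∉F
        go _   ((_ , y∉F , _) ◅ w) = go y∉F w

      cell-closed : ∀ {C} → IsCell X F C → ∀ {x y} → x ∈ C → x ~ y → y ∉ F → y ∈ C
      cell-closed cell@(_ , _ , C⊆ , ⊆C) x∈C x~y y∉F =
        ⊆C (C⊆ x∈C ◅◅ (cell⊆∁F cell x∈C , y∉F , x~y) ◅ ε)

      -- Walks can be reversed, so any vertex of a component can replace its base point.
      cell≐cell-of : ∀ {C} → IsCell X F C → ∀ {x} → x ∈ C → C ≐ cell-of x
      cell≐cell-of (_ , _ , C⊆ , ⊆C) x∈C =
        (λ y∈C → reverse (λ (s , t , x~y) → t , s , ~-sym x~y) (C⊆ x∈C) ◅◅ C⊆ y∈C) ,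
        (λ w → ⊆C (C⊆ x∈C ◅◅ w))

      boundary⊆F : ∀ {C} → IsCell X F C → boundary X C ⊆ F
      boundary⊆F cell (y∉C , _ , x∈C , x~y) =
        decidable-stable em (y∉C ∘ cell-closed cell x∈C x~y)

      ~cell⇒∈boundary : ∀ {C} → IsCell X F C → ∀ {x y} → x ∈ C → x ~ y → y ∈ F →
                        y ∈ boundary X C
      ~cell⇒∈boundary cell x∈C x~y y∈F =
        (λ y∈C → cell⊆∁F cell y∈C y∈F) , _ , x∈C , x~y

      boundary-resp-≐ : ∀ {C D : Pred V ℓ} → C ≐ D → boundary X C ⊆ boundary X D
      boundary-resp-≐ (C⊆D , D⊆C) (y∉C , x , x∈C , x~y) = y∉C ∘ D⊆C , x , C⊆D x∈C , x~y

      -- Consequences of self-similarity.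

      module Homogeneous (ψ : V → V) (hss : IsHomogeneouslySelfSimilar X F ψ) where
        open IsHomogeneouslySelfSimilar hss
        open IsSelfSimilar selfSimilar
        open IsIsomorphism F3

        ψ∈F : ∀ x → ψ x ∈ F
        ψ∈F x = maps-to _

        ψ-injective : ∀ {x y} → ψ x ≡ ψ y → x ≡ y
        ψ-injective = injective _ _

        ψ⁻¹ : ∀ {y} → y ∈ F → ∃[ x ] ψ x ≡ y
        ψ⁻¹ y∈F = let x , _ , ψx≡y = surjective y∈F in x , ψx≡y

        ~⇒common-cell : ∀ {x y} → x ~ y →
          ∃[ C ] IsCell X F C × ψ x ∈ boundary X C × ψ y ∈ boundary X C
        ~⇒common-cell x~y = proj₂ (proj₂ (proj₂ (to (adjacency _ _) x~y)))

        common-cell⇒~ : ∀ {C} → IsCell X F C → ∀ {x y} →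
          ψ x ∈ boundary X C → ψ y ∈ boundary X C → x ≢ y → x ~ y
        common-cell⇒~ {C} cell x∈θC y∈θC x≢y = from (adjacency _ _)
          (ψ∈F _ , ψ∈F _ , x≢y ∘ ψ-injective , C , cell , x∈θC , y∈θC)

        -- The contrapositive of `F2`: two boundary vertices determine their cell.
        common-boundary⇒≐ : ∀ {C D} → IsCell X F C → IsCell X F D → ∀ {x y} → x ≢ y →
          x ∈ boundary X C → x ∈ boundary X D → y ∈ boundary X C → y ∈ boundary X D →
          C ≐ D
        common-boundary⇒≐ cellC cellD x≢y xC xD yC yD = decidable-stable em
          (λ C≉D → x≢y (F2 cellC cellD C≉D (inj₂ xC) (inj₂ xD) (inj₂ yC) (inj₂ yD)))

        neighbour∉F : ∀ {x y} → x ∈ F → x ~ y → y ∉ F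
        neighbour∉F x∈F x~y y∈F = F1 x∈F y∈F x~y

        -- Outside `F`, all neighbours of `v` lie in the closure of its cell, which is finite by
        -- `H1-finite`.
        infinite-degree⇒∈F : ∀ {v} → Infinite (neighbours X v) → v ∈ F
        infinite-degree⇒∈F {v} inf = decidable-stable em λ v∉F →
          inf (⊆-Finite (neighbours⊆closure v∉F) (H1-finite (cell-of-isCell v∉F)))
          where
          neighbours⊆closure : v ∉ F → neighbours X v ⊆ closure X (cell-of v)
          neighbours⊆closure v∉F {y} v~y with em {P = y ∈ F}
          ... | yes y∈F = inj₂ (~cell⇒∈boundary (cell-of-isCell v∉F) ε v~y y∈F)
          ... | no  y∉F = inj₁ (cell-closed (cell-of-isCell v∉F) ε v~y y∉F)

        -- Halving of walks.

        mutual

          -- A walk starting inside a cell C is treated as if it had started,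
          -- one edge earlier, at any chosen boundary vertex ψ x of C.
          halve-from-cell : ∀ {C} → IsCell X F C → ∀ {p x y} → p ∈ C →
            ψ x ∈ boundary X C → (w : Star _~_ p (ψ y)) →
            Σ[ w′ ∈ Star _~_ x y ] length X w′ + length X w′ ≤ suc (length X w)
          halve-from-cell cell p∈C _ ε = contradiction (ψ∈F _) (cell⊆∁F cell p∈C)
          halve-from-cell cell {x = x} p∈C ψx∈θC (_◅_ {j = p′} p~p′ w) with em {P = p′ ∈ F}
          ... | no p′∉F =
            let w′ , bound = halve-from-cell cell (cell-closed cell p∈C p~p′ p′∉F) ψx∈θC w
            in w′ , m≤n⇒m≤1+n bound
          ... | yes p′∈F with ψ⁻¹ p′∈F
          ... | x′ , refl with halve refl w | em {P = x ≡ x′}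
          -- The walk leaves the cell at `ψ x` again, so this excursion contributes no edge.
          ... | w′ , bound | yes refl = w′ , m≤n⇒m≤1+n (m≤n⇒m≤1+n bound)
          -- The new edge from `x` to `x′` is paid for by two edges: the one assumed before `p` and
          -- the one leaving the cell.
          ... | w′ , bound | no x≢x′  =
            common-cell⇒~ cell ψx∈θC (~cell⇒∈boundary cell p∈C p~p′ p′∈F) x≢x′ ◅ w′ ,
            s≤s (≤-trans (≤-reflexive (+-suc _ _)) (s≤s bound))

          -- By `F1` the first edge enters a cell with `ψ x` on its boundary; it is the extra edge
          -- counted in `halve-from-cell`. The start `p` is kept apart from `ψ x` so that the walk
          -- can be matched against `ε`.
          halve : ∀ {x y p} → ψ x ≡ p → (w : Star _~_ p (ψ y)) →
            Σ[ w′ ∈ Star _~_ x y ] length X w′ + length X w′ ≤ length X w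
          halve ψx≡ψy ε with refl ← ψ-injective ψx≡ψy = ε , z≤n
          halve refl (ψx~p ◅ w) =
            let p∉F  = neighbour∉F (ψ∈F _) ψx~p
                cell = cell-of-isCell p∉F
            in halve-from-cell cell ε (~cell⇒∈boundary cell ε (~-sym ψx~p) (ψ∈F _)) w

        -- Each halving removes one `ψ` at both ends and lowers the length bound from `suc n` to
        -- `n`; at `0` the walk is empty.
        short-walk⇒≡ : ∀ n {x y p q} → fold x ψ n ≡ p → fold y ψ n ≡ q →
                       (w : Star _~_ p q) → length X w ≤ n → x ≡ y
        short-walk⇒≡ zero    refl refl ε _ = refl
        short-walk⇒≡ (suc n) refl refl w short =
          let w′ , bound = halve refl w
          in short-walk⇒≡ n refl refl w′ (doubled-≤-suc (length X w′) (≤-trans bound short))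

        -- If `v` is the `n`-th iterate of `x`, then `ψ v` is that of `ψ x`. A fixed walk from `v`
        -- to `ψ v` is short for large `n`, which forces `x ≡ ψ x`.
        in-all-Fⁿ⇒origin : Connected X → ∀ {v} →
          (∀ n → 1 ≤ n → v ∈ iterateImage ψ n) → IsOrigin ψ v
        in-all-Fⁿ⇒origin conn {v} v∈Fⁿ =
          let w        = conn v (ψ v)
              -- The length itself would suffice as a bound; the successor ensures `1 ≤ n`.
              n        = suc (length X w)
              x , ψⁿx≡v = v∈Fⁿ n (s≤s z≤n)
              ψⁿψx≡ψv  = trans (fold-comm ψ x n) (cong ψ ψⁿx≡v)
              x≡ψx     = short-walk⇒≡ n ψⁿx≡v ψⁿψx≡ψv w (n≤1+n _)
          in trans (sym ψⁿψx≡ψv) (trans (cong (λ z → fold z ψ n) (sym x≡ψx)) ψⁿx≡v)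

        origin⇒in-all-Fⁿ : ∀ {v} → IsOrigin ψ v → ∀ n → 1 ≤ n → v ∈ iterateImage ψ n
        origin⇒in-all-Fⁿ origin n _ = _ , fixed⇒fold-fixed ψ origin n

        -- Degrees under `ψ`.

        module _ (conn : Connected X) (inf : Infinite (U {A = V}))
                 {t} (size : HasBoundarySize X F t) where

          -- An edge at `v` yields a cell with two distinct boundary vertices, and all cells have
          -- boundary size `t`.
          2≤θ : V → 2 ≤ t
          2≤θ v =
            let u , v~u                 = ∃-neighbour conn inf v
                _ , cell , ψv∈θC , ψu∈θC = ~⇒common-cell v~u
            in two-elements⇒2≤ (size cell) ψv∈θC ψu∈θC
                 (λ e → ~-irrefl (ψ-injective e) v~u)

          -- Each cell at `ψ w` has another boundary vertex `ψ u`, where `u` is a neighbour of `w`.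
          -- Since `u` determines the cell, finitely many finite cells contain all neighbours of
          -- `ψ w`.
          finite-degree-ψ : ∀ w → Finite (neighbours X w) → Finite (neighbours X (ψ w))
          finite-degree-ψ w (_ , us , _ , _ , w~⇔us) =
            ⊆-list⇒Finite (concatMap members us) covered
            where
            Joining : V → Set _
            Joining u = ∃[ C ] IsCell X F C × ψ w ∈ boundary X C × ψ u ∈ boundary X C

            -- The decision is an argument so that `∈-members` can match on it. The default `[]` is
            -- for a `u` such that no cell has both `ψ w` and `ψ u` on its boundary.
            members′ : ∀ {u} → Dec (Joining u) → List V
            members′ (yes (_ , cell , _)) = proj₁ (proj₂ (H1-finite cell))
            members′ (no _)               = []

            members : V → List V
            members u = members′ {u} em

            ∈-members : ∀ {C} → IsCell X F C → ∀ {u y} → u ≢ w → y ∈ C →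
              ψ w ∈ boundary X C → ψ u ∈ boundary X C → (d : Dec (Joining u)) →
              y ∈ₗ members′ d
            ∈-members cell u≢w y∈C ψwC ψuC (no none) = ⊥-elim (none (_ , cell , ψwC , ψuC))
            -- The cell picked by `em` shares `ψ u` and `ψ w` with the given one, so they coincide.
            ∈-members cell u≢w y∈C ψwC ψuC (yes (_ , cellD , ψwD , ψuD)) =
              to (proj₂ (proj₂ (proj₂ (proj₂ (H1-finite cellD)))) _) (inj₁
                (proj₁ (common-boundary⇒≐ cell cellD (u≢w ∘ ψ-injective) ψuC ψuD ψwC ψwD)
                       y∈C))

            covered : ∀ {y} → ψ w ~ y → y ∈ₗ concatMap members us
            covered ψw~y
              with cell ← cell-of-isCell (neighbour∉F (ψ∈F w) ψw~y)
              with ψwC ← ~cell⇒∈boundary cell ε (~-sym ψw~y) (ψ∈F w)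
              with _ , uC , u≢ψw ← ∃-other (size cell) (2≤θ w) (λ _ _ → em) (ψ w)
              with u , refl ← ψ⁻¹ (boundary⊆F cell uC) =
              ∈-concatMap⁺ members (lose
                (to (w~⇔us u) (common-cell⇒~ cell ψwC uC (u≢ψw ∘ cong ψ ∘ sym)))
                (∈-members cell (u≢ψw ∘ cong ψ) ε ψwC uC em))

          -- Infinite degree puts `v` into `F` and passes to its preimage `w` under `ψ`, to which
          -- the induction applies.
          infinite-degree⇒in-all-Fⁿ : ∀ n {v} → Infinite (neighbours X v) →
                                      v ∈ iterateImage ψ n
          infinite-degree⇒in-all-Fⁿ zero    {v} _   = v , refl
          infinite-degree⇒in-all-Fⁿ (suc n) v-inf
            with w , refl ← ψ⁻¹ (infinite-degree⇒∈F v-inf)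
            with x , refl ← infinite-degree⇒in-all-Fⁿ n {w} (v-inf ∘ finite-degree-ψ w) =
            x , refl

          -- Double counting of the pairs (x , y) of neighbours of v = ψ v such
          -- that ψ y lies on the boundary of the cell containing x.
          origin⇒infinite-degree : ∀ {b} → IsConstantInnerDegree X F b → t < b + 1 →
            ∀ {v} → IsOrigin ψ v → Infinite (neighbours X v)
          origin⇒infinite-degree {b} inner t<b+1 {v} origin (_ , xs , xs! , _ , v~⇔xs) =
            no-neighbours xs counted (to (v~⇔xs _) (proj₂ (∃-neighbour conn inf v)))
            where
            R? : ∀ x y → Dec (ψ y ∈ boundary X (cell-of x))
            R? _ _ = em

            v∈F : v ∈ F
            v∈F = subst F origin (ψ∈F v)

            module _ {x} (x∈xs : x ∈ₗ xs) where
              v~x : v ~ x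
              v~x = from (v~⇔xs x) x∈xs

              cell : IsCell X F (cell-of x)
              cell = cell-of-isCell (neighbour∉F v∈F v~x)

              v∈θ : v ∈ boundary X (cell-of x)
              v∈θ = ~cell⇒∈boundary cell ε (~-sym v~x) v∈F

            -- The successor counts `v` itself: it lies on the boundary as `ψ v`, but is not its own
            -- neighbour.
            suc-row : ∀ {x} → x ∈ₗ xs → suc (row R? xs x) ≡ t
            suc-row {x} x∈xs = trans (cong suc (sym (length-map ψ ys)))
              (HasSize⇒length (size (cell x∈xs)) listing! (λ u → mk⇔ listed boundary-vertex))
              where
              ys = filter (R? x) xs

              v≢ψys : ∀ {y} → y ∈ₗ ys → v ≢ ψ y
              v≢ψys y∈ys v≡ψy = ~-irrefl (ψ-injective (trans origin v≡ψy))
                (from (v~⇔xs _) (proj₁ (∈-filter⁻ (R? x) {xs = xs} y∈ys)))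

              listing! : Unique (v ∷ List.map ψ ys)
              listing! = All.map⁺ (All.tabulate v≢ψys) ∷
                         Unique.map⁺ ψ-injective (Unique.filter⁺ (R? x) xs!)

              listed : ∀ {u} → u ∈ boundary X (cell-of x) → u ∈ₗ v ∷ List.map ψ ys
              listed {u} u∈θ with em {P = u ≡ v}
              ... | yes u≡v = here u≡v
              ... | no  u≢v with y , refl ← ψ⁻¹ (boundary⊆F (cell x∈xs) u∈θ) =
                there (∈-map⁺ ψ (∈-filter⁺ (R? x) (to (v~⇔xs y) v~y) u∈θ))
                where
                v~y : v ~ y
                v~y = common-cell⇒~ (cell x∈xs)
                        (subst (boundary X (cell-of x)) (sym origin) (v∈θ x∈xs)) u∈θ
                        (λ v≡y → u≢v (trans (cong ψ (sym v≡y)) origin))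

              boundary-vertex : ∀ {u} → u ∈ₗ v ∷ List.map ψ ys → u ∈ boundary X (cell-of x)
              boundary-vertex (here refl) = v∈θ x∈xs
              boundary-vertex (there u∈) with y , y∈ys , refl ← ∈-map⁻ ψ u∈ =
                proj₂ (∈-filter⁻ (R? x) {xs = xs} y∈ys)

            -- The vertices `v` and `ψ y` determine one cell `C`, so the column consists of the
            -- neighbours of `v` in `C`; by `F1` none lie on its boundary.
            column≡b : ∀ {y} → y ∈ₗ xs → column R? xs y ≡ b
            column≡b {y} y∈xs
              with v~y ← from (v~⇔xs y) y∈xs
              with C , cellC , ψvC , ψyC ← ~⇒common-cell v~y =
              HasSize⇒length (inner cellC vC) (Unique.filter⁺ (λ x → R? x y) xs!)
                             (λ x → mk⇔ listed neighbour)
              where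
              vC : v ∈ boundary X C
              vC = subst (boundary X C) origin ψvC

              v≢ψy : v ≢ ψ y
              v≢ψy v≡ψy = ~-irrefl (ψ-injective (trans origin v≡ψy)) v~y

              listed : ∀ {x} → x ∈ neighboursIn X (closure X C) v →
                       x ∈ₗ filter (λ x → R? x y) xs
              listed {x} (inj₁ x∈C , v~x) = ∈-filter⁺ (λ x → R? x y) (to (v~⇔xs x) v~x)
                (boundary-resp-≐ (cell≐cell-of cellC x∈C) ψyC)
              listed (inj₂ x∈θC , v~x) =
                contradiction (boundary⊆F cellC x∈θC) (neighbour∉F v∈F v~x)

              neighbour : ∀ {x} → x ∈ₗ filter (λ x → R? x y) xs →
                          x ∈ neighboursIn X (closure X C) v
              neighbour x∈ =
                let x∈xs , ψy∈θ = ∈-filter⁻ (λ x → R? x y) {xs = xs} x∈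
                in inj₁ (proj₂ (common-boundary⇒≐ cellC (cell x∈xs) v≢ψy
                           vC (v∈θ x∈xs) ψyC ψy∈θ) ε) ,
                   v~x x∈xs

            rows≡columns : ∀ {r} → (∀ {x} → x ∈ₗ xs → row R? xs x ≡ r) →
                    List.length xs * r ≡ List.length xs * b
            rows≡columns row≡r = begin
              List.length xs * _              ≡⟨ sum-map-const _ xs row≡r ⟨
              sum (List.map (row R? xs) xs)    ≡⟨ double-counting R? xs xs ⟩
              sum (List.map (column R? xs) xs) ≡⟨ sum-map-const _ xs column≡b ⟩
              List.length xs * b              ∎
              where open ≡-Reasoning

            -- Here `r` is θ_X - 1 without truncated subtraction, and `t < b + 1` becomes `r < b`.
            ∃r : ∃[ r ] suc r ≡ t
            ∃r with s≤s {n = r} _ ← 2≤θ v = r , refl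

            counted : ∃[ r ] r < b × List.length xs * r ≡ List.length xs * b
            counted with r , refl ← ∃r =
              r , ≤-pred (subst (suc r <_) (+-comm b 1) t<b+1) ,
              rows≡columns (λ x∈xs → suc-injective (suc-row x∈xs))

            -- Generalising over `zs` lets a match expose a positive length, which is then
            -- cancelled.
            no-neighbours : ∀ zs →
              (∃[ r ] r < b × List.length zs * r ≡ List.length zs * b) →
              ∀ {z} → ¬ z ∈ₗ zs
            no-neighbours (z ∷ zs) (r , r<b , eq) _ =
              <⇒≢ r<b (*-cancelˡ-≡ r b (suc (List.length zs)) eq)

theorem4 : ∀ {ℓ} → (∀ {a} → ExcludedMiddle a) →
    {V : Set ℓ} (X : Graph V ℓ) → Connected X → Infinite (U {A = V}) →
    (F : Pred V ℓ) (ψ : V → V) → IsHomogeneouslySelfSimilar X F ψ →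
    (b t : ℕ) → IsConstantInnerDegree X F b → HasBoundarySize X F t → t < b + 1 →
    (v : V) →
    (Infinite (neighbours X v) ⇔ (∀ n → 1 ≤ n → v ∈ iterateImage ψ n)) ×
    ((∀ n → 1 ≤ n → v ∈ iterateImage ψ n) ⇔ IsOrigin ψ v)
theorem4 em X conn inf F ψ hss b t inner size t<b+1 v =
  mk⇔ (λ v-inf n _ → infinite-degree⇒in-all-Fⁿ conn inf size n v-inf)
      -- The way from (ii) back to (i) passes through (iii).
      (origin⇒infinite-degree conn inf size inner t<b+1 ∘ in-all-Fⁿ⇒origin conn) ,
  mk⇔ (in-all-Fⁿ⇒origin conn) origin⇒in-all-Fⁿ
  where
  open Cells em X F
  open Homogeneous ψ hss
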